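{- For all $n\ge 0$, the distribution of the quadruple $(\operatorname{asc},\operatorname{des},\operatorname{MNA},\operatorname{MND})$ on $S_n(231,312)$ equals the distribution of $(\operatorname{des},\operatorname{asc},\operatorname{MND},\operatorname{MNA})$ on $S_n(213,231)$, i.e. $$\sum_{\pi\in S_n(231,312)} t_1^{\operatorname{asc}(\pi)}t_2^{\operatorname{des}(\pi)}t_3^{\operatorname{MNA}(\pi)}t_4^{\operatorname{MND}(\pi)}=\sum_{\sigma\in S_n(213,231)} t_1^{\operatorname{des}(\sigma)}t_2^{\operatorname{asc}(\sigma)}t_3^{\operatorname{MND}(\sigma)}t_4^{\operatorname{MNA}(\sigma)}.$$
   Context: For $n\ge 0$, $S_n$ denotes the set of permutations $\pi=\pi_1\cdots\pi_n$ of $[n]=\{1,\dots,n\}$. $\pi$ avoids a pattern $\tau\in S_k$ if no subsequence $\pi_{i_1}\cdots\pi_{i_k}$ ($i_1<\dots<i_k$) satisfies $\pi_{i_a}<\pi_{i_b}\iff\tau_a<\tau_b$; $S_n(\tau,\rho)$ is the set of permutations in $S_n$ avoiding both $\tau$ and $\rho$. $\operatorname{asc}(\pi)$ (resp. $\operatorname{des}(\pi)$) is the number of $i\in[n-1]$ with $\pi_i<\pi_{i+1}$ (resp. $\pi_i>\pi_{i+1}$). $\operatorname{MNA}(\pi)$ is the maximum size of a set $I\subseteq[n-1]$ such that $\pi_i<\pi_{i+1}$ for all $i\in I$ and $|i-j|\ge 2$ for distinct $i,j\in I$; $\operatorname{MND}(\pi)$ is defined analogously with $\pi_i>\pi_{i+1}$.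 -}

module Defs where

open import Algebra.Bundles using (CommutativeSemiring)
open import Data.Fin using (Fin; zero; suc; toℕ; inject₁; _<_; _>_; #_)
open import Data.Fin.Properties using (_≟_; _<?_; all?)
open import Data.Fin.Subset using (Subset; inside; outside; _∈_; ∣_∣)
open import Data.Fin.Subset.Properties using (_∈?_)
open import Data.List as List using (List; allFin; cartesianProductWith; filter; foldr; length)
open import Data.List.Extrema.Nat using (max)
import Data.List.Membership.Propositional as Membership
open import Data.List.Membership.Propositional.Properties
  using (∈-allFin; ∈-cartesianProductWith⁺)
import Data.List.Relation.Unary.Any as Any
open import Data.Nat as ℕ using (ℕ; zero; suc; pred; _≥_; ∣_-_∣)
open import Data.Product using (_×_; _,_; ∃-syntax)
open import Data.Product.Properties using (≡-dec)
open import Data.Vec using (Vec; []; _∷_; lookup)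
import Data.Vec.Relation.Unary.AllPairs as AllPairs
open import Data.Vec.Relation.Unary.Unique.Propositional using (Unique)
open import Function using (_∘_; _⇔_; mk⇔; Equivalence)
open import Level using (Level; 0ℓ)
open import Relation.Binary.Definitions using (DecidableEquality)
open import Relation.Binary.PropositionalEquality using (_≡_; _≢_; refl)
open import Relation.Nullary using (¬_)
open import Relation.Nullary.Decidable using (map′; ¬?; _×-dec_; _→-dec_)
open import Relation.Unary using (Pred; Decidable)

private variable
  a c ℓ : Level
  A : Set a
  k m n : ℕ

vectors : List A → (k : ℕ) → List (Vec A k)
vectors xs zero    = List.[ [] ]
vectors xs (suc k) = cartesianProductWith _∷_ xs (vectors xs k)

∈-vectors : {xs : List A} → (∀ x → x Membership.∈ xs) → (v : Vec A k) → v Membership.∈ vectors xs k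
∈-vectors all []      = Any.here refl
∈-vectors all (x ∷ v) = ∈-cartesianProductWith⁺ _∷_ (all x) (∈-vectors all v)

-- Words π₁⋯πₙ over [n] in one-line notation; positions and letters are both
-- numbered from 0.
Word : ℕ → Set
Word n = Vec (Fin n) n

-- A word of length n over [n] is a permutation iff its letters are distinct.
IsPermutation : Pred (Word n) 0ℓ
IsPermutation = Unique

isPermutation? : Decidable (IsPermutation {n})
isPermutation? = AllPairs.allPairs? (λ i j → ¬? (i ≟ j))

Increasing : Pred (Vec (Fin n) k) 0ℓ
Increasing is = ∀ a b → a < b → lookup is a < lookup is b

OccursAt : Word k → Word n → Pred (Vec (Fin n) k) 0ℓ
OccursAt τ π is =
  ∀ a b → lookup π (lookup is a) < lookup π (lookup is b) ⇔ lookup τ a < lookup τ b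

Contains : Word k → Pred (Word n) 0ℓ
Contains {k} {n} τ π = ∃[ is ] Increasing {n} {k} is × OccursAt τ π is

Avoids : Word k → Pred (Word n) 0ℓ
Avoids τ π = ¬ Contains τ π

increasing? : Decidable (Increasing {n} {k})
increasing? is = all? λ a → all? λ b → (a <? b) →-dec (lookup is a <? lookup is b)

occursAt? : (τ : Word k) (π : Word n) → Decidable (OccursAt τ π)
occursAt? τ π is = all? λ a → all? λ b →
  let l? = lookup π (lookup is a) <? lookup π (lookup is b)
      r? = lookup τ a <? lookup τ b
  in map′ (λ (f , g) → mk⇔ f g) (λ e → Equivalence.to e , Equivalence.from e)
          ((l? →-dec r?) ×-dec (r? →-dec l?))

contains? : (τ : Word k) → Decidable (Contains {k} {n} τ)
contains? {k} {n} τ π =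
  map′ (λ any → let is , _ , occ = Membership.find any in is , occ)
       (λ (is , occ) → Membership.lose (∈-vectors ∈-allFin is) occ)
       (Any.any? (λ is → increasing? is ×-dec occursAt? τ π is) (vectors (allFin n) k))

avoids? : (τ : Word k) → Decidable (Avoids {k} {n} τ)
avoids? τ π = ¬? (contains? τ π)

S : (n : ℕ) → Word k → Word m → List (Word n)
S n τ ρ = filter (λ π → isPermutation? π ×-dec (avoids? τ π ×-dec avoids? ρ π))
                 (vectors (allFin n) n)

213ₚ 231ₚ 312ₚ : Word 3
213ₚ = # 1 ∷ # 0 ∷ # 2 ∷ []
231ₚ = # 1 ∷ # 2 ∷ # 0 ∷ []
312ₚ = # 2 ∷ # 0 ∷ # 1 ∷ []

AscentAt DescentAt : Word n → Pred (Fin (pred n)) 0ℓ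
AscentAt  {suc n} π i = lookup π (inject₁ i) < lookup π (suc i)
DescentAt {suc n} π i = lookup π (inject₁ i) > lookup π (suc i)

ascentAt? : (π : Word n) → Decidable (AscentAt π)
ascentAt? {suc n} π i = lookup π (inject₁ i) <? lookup π (suc i)

descentAt? : (π : Word n) → Decidable (DescentAt π)
descentAt? {suc n} π i = lookup π (suc i) <? lookup π (inject₁ i)

count : {P : Pred (Fin m) 0ℓ} → Decidable P → ℕ
count P? = length (filter P? (allFin _))

NonAdjacent : Pred (Fin m) 0ℓ → Pred (Subset m) 0ℓ
NonAdjacent P I =
    (∀ i → i ∈ I → P i)
  × (∀ i j → i ∈ I → j ∈ I → i ≢ j → ∣ toℕ i - toℕ j ∣ ≥ 2)

nonAdjacent? : {P : Pred (Fin m) 0ℓ} → Decidable P → Decidable (NonAdjacent P)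
nonAdjacent? P? I =
  all? (λ i → (i ∈? I) →-dec P? i)
  ×-dec
  all? (λ i → all? λ j → (i ∈? I) →-dec ((j ∈? I) →-dec
    (¬? (i ≟ j) →-dec (2 ℕ.≤? ∣ toℕ i - toℕ j ∣))))

subsets : (m : ℕ) → List (Subset m)
subsets m = vectors (outside List.∷ inside List.∷ List.[]) m

-- The default value 0 is harmless: the empty set is always non-adjacent.
maxNonAdjacent : {P : Pred (Fin m) 0ℓ} → Decidable P → ℕ
maxNonAdjacent P? = max 0 (List.map ∣_∣ (filter (nonAdjacent? P?) (subsets _)))

asc des MNA MND : Word n → ℕ
asc π = count (ascentAt? π)
des π = count (descentAt? π)
MNA π = maxNonAdjacent (ascentAt? π)
MND π = maxNonAdjacent (descentAt? π)

Quadruple : Set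
Quadruple = ℕ × ℕ × ℕ × ℕ

_≟⁴_ : DecidableEquality Quadruple
_≟⁴_ = ≡-dec ℕ._≟_ (≡-dec ℕ._≟_ (≡-dec ℕ._≟_ ℕ._≟_))

distribution : (A → Quadruple) → List A → Quadruple → ℕ
distribution stat xs q = length (filter (λ x → stat x ≟⁴ q) xs)

-- Formal polynomials are represented by their values at all points of all
-- commutative semirings; this loses nothing, since ℕ[t₁,t₂,t₃,t₄] is one.
module _ (R : CommutativeSemiring c ℓ) where
  open CommutativeSemiring R
  open import Algebra.Properties.Semiring.Exp semiring using (_^_)

  monomial : (t₁ t₂ t₃ t₄ : Carrier) → Quadruple → Carrier
  monomial t₁ t₂ t₃ t₄ (e₁ , e₂ , e₃ , e₄) = t₁ ^ e₁ * t₂ ^ e₂ * t₃ ^ e₃ * t₄ ^ e₄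

  generatingFunction : (A → Quadruple) → List A → (t₁ t₂ t₃ t₄ : Carrier) → Carrier
  generatingFunction stat xs t₁ t₂ t₃ t₄ =
    foldr _+_ 0# (List.map (monomial t₁ t₂ t₃ t₄ ∘ stat) xs)

-- Both classes are coded by the subsets I of the m adjacent pairs of positions
-- of a word of length m + 1. A permutation avoiding 231 and 312 is a sequence of
-- decreasing layers and is determined by its set of ascents; in a permutation
-- avoiding 213 and 231 every letter is the minimum or the maximum of the suffix
-- it starts, so it is determined by its set of descents. In both cases every I
-- occurs. Matching the two permutations coded by the same I exchanges ascents
-- and descents position by position, and all four statistics depend on nothing else.

module Submission where

open import Defs
open import Algebra.Bundles using (CommutativeSemiring)
open import Data.Bool using (true; false)
open import Data.Fin using (Fin; zero; suc; toℕ; fromℕ<; inject₁; lower₁; punchOut; _<_; _≤_)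
open import Data.Fin.Induction using (<-weakInduction)
open import Data.Fin.Properties
  using (_≟_; _<?_; _≤?_; <-cmp; <-trans; <-asym; <-irrefl; ≤-antisym; ≤∧≢⇒<; any?;
         toℕ-injective; toℕ-fromℕ<; toℕ-inject₁; toℕ<n; inject₁-injective;
         inject₁-lower₁; injective⇒≤; punchOut-injective; ≤̄⇒inject₁<)
open import Data.Fin.Subset using (Subset; _∈_; _∉_; ∣_∣)
open import Data.Fin.Subset.Properties
  using (_∈?_; ∈⊤; ⊆⊤; ∣⊤∣≡n; ⊆-antisym; p⊂q⇒∣p∣<∣q∣)
open import Data.List using (List; []; _∷_; map; length; allFin)
open import Data.List.Extrema.Nat using (max)
import Data.List.Membership.Propositional as Membership
open import Data.List.Membership.Propositional.Properties
  using (∈-allFin; ∈-filter⁺; ∈-filter⁻; ∈-map⁺; ∈-map⁻)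
open import Data.List.Membership.Propositional.Properties.WithK using (unique∧set⇒bag)
open import Data.List.Properties using (filter-≐; map-cong; map-∘)
open import Data.List.Relation.Binary.BagAndSetEquality using (∼bag⇒↭)
open import Data.List.Relation.Binary.Permutation.Propositional
  using (_↭_; ↭-refl; ↭⇒↭ₛ; module PermutationReasoning)
open import Data.List.Relation.Binary.Permutation.Propositional.Properties
  using (filter-↭; ↭-length) renaming (map⁺ to ↭-map⁺)
import Data.List.Relation.Binary.Permutation.Setoid.Properties as Permutationₛ
open import Data.List.Relation.Unary.All using ([]; _∷_)
open import Data.List.Relation.Unary.AllPairs using ([]; _∷_)
open import Data.List.Relation.Unary.Any using (here; there)
open import Data.List.Relation.Unary.Unique.Propositional using (Unique)
open import Data.List.Relation.Unary.Unique.Propositional.Properties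
  using (filter⁺; cartesianProductWith⁺; allFin⁺) renaming (map⁺ to Unique-map⁺)
open import Data.Nat as ℕ using (ℕ; zero; suc; z≤n; s≤s)
import Data.Nat.Properties as ℕ
open import Data.Product using (_×_; _,_; ∃-syntax; proj₁; proj₂)
open import Data.Sum using (_⊎_; inj₁; inj₂; [_,_]′)
open import Data.Vec using (Vec; []; _∷_; lookup; tabulate)
open import Data.Vec.Properties
  using (lookup∘tabulate; tabulate∘lookup; tabulate-cong; []=⇒lookup; lookup⇒[]=; ∷-injective)
open import Data.Vec.Relation.Unary.Unique.Propositional.Properties
  using (lookup-injective; tabulate⁺)
open import Function using (_∘_; id; _⇔_; mk⇔; Equivalence; Injective)
open import Function.Construct.Composition using (_⇔-∘_)
open import Function.Construct.Symmetry using (⇔-sym)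
open import Level using (Level; 0ℓ)
open import Relation.Binary.Core using (Rel)
open import Relation.Binary.Definitions using (tri<; tri≈; tri>) renaming (Decidable to Decidable₂)
open import Relation.Binary.PropositionalEquality
  using (_≡_; _≢_; refl; sym; trans; cong; cong₂; subst; subst₂; setoid)
open import Relation.Nullary using (¬_; yes; no; does; contradiction)
open import Relation.Nullary.Decidable
  using (dec-true; decidable-stable; ¬?; _×-dec_; _⊎-dec_)
open import Relation.Unary using (Pred; Decidable)

open Equivalence using (to; from)

private variable
  a b c ℓ : Level
  A : Set a
  B : Set b
  k m n : ℕ

-- Finite sets, and permutations as determined by their order relations.

⟦_⟧ : {P : Pred (Fin n) 0ℓ} → Decidable P → Subset n
⟦ P? ⟧ = tabulate (does ∘ P?)

∈⟦⟧⁺ : {P : Pred (Fin n) 0ℓ} (P? : Decidable P) {i : Fin n} → P i → i ∈ ⟦ P? ⟧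
∈⟦⟧⁺ P? {i} p = lookup⇒[]= i _ (trans (lookup∘tabulate _ i) (dec-true (P? i) p))

∈⟦⟧⁻ : {P : Pred (Fin n) 0ℓ} (P? : Decidable P) {i : Fin n} → i ∈ ⟦ P? ⟧ → P i
∈⟦⟧⁻ P? {i} i∈ with P? i | trans (sym (lookup∘tabulate (does ∘ P?) i)) ([]=⇒lookup i∈)
... | yes p | _ = p

-- Pigeonhole: were `y` missed, punching it out of the codomain would inject `suc n` points into
-- `n`.
injective⇒surjective : {f : Fin n → Fin n} → Injective _≡_ _≡_ f → ∀ y → ∃[ x ] f x ≡ y
injective⇒surjective {suc n} {f} f-inj y with any? (λ x → f x ≟ y)
... | yes hit = hit
... | no miss = contradiction (injective⇒≤ squeezed-injective) ℕ.1+n≰n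
  where
  y≢f : ∀ x → y ≢ f x
  y≢f x y≡fx = miss (x , sym y≡fx)

  squeezed-injective : Injective _≡_ _≡_ (λ x → punchOut (y≢f x))
  squeezed-injective {x} {x′} = f-inj ∘ punchOut-injective (y≢f x) (y≢f x′)

≮∧≢⇒> : {i j : Fin n} → ¬ i < j → i ≢ j → j < i
≮∧≢⇒> i≮j i≢j = ≤∧≢⇒< (ℕ.≮⇒≥ i≮j) (i≢j ∘ sym)

inject₁<suc : (k : Fin n) → inject₁ k < suc k
inject₁<suc k = ≤̄⇒inject₁< ℕ.≤-refl

inject₁<⇒suc≤ : {k : Fin n} {j : Fin (suc n)} → inject₁ k < j → suc k ≤ j
inject₁<⇒suc≤ {k = k} {j} = subst (λ x → x ℕ.< toℕ j) (toℕ-inject₁ k)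

perm-injective : {π : Word n} → IsPermutation π → Injective _≡_ _≡_ (lookup π)
perm-injective π! = lookup-injective π! _ _

perm-≮⇒> : {π : Word n} → IsPermutation π → ∀ {i j} → i ≢ j →
           ¬ lookup π i < lookup π j → lookup π j < lookup π i
perm-≮⇒> π! i≢j ≮ = ≮∧≢⇒> ≮ (i≢j ∘ perm-injective π!)

lookup-ext : {v w : Vec A n} → (∀ i → lookup v i ≡ lookup w i) → v ≡ w
lookup-ext {v = v} {w} eq =
  trans (sym (tabulate∘lookup v)) (trans (tabulate-cong eq) (tabulate∘lookup w))

-- Induction on the value of `π` at `i`. The next smaller value is attained at some position `j`;
-- the bound for `j` and the strict step from `σ` at `j` to `σ` at `i` give the bound for `i`.
order-preserving⇒≤ : (π σ : Word n) → IsPermutation π →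
  (∀ {i j} → lookup π i < lookup π j → lookup σ i < lookup σ j) →
  ∀ i → lookup π i ≤ lookup σ i
order-preserving⇒≤ {suc _} π σ π! mono i =
  <-weakInduction (λ v → ∀ i → lookup π i ≡ v → v ≤ lookup σ i) (λ _ _ → z≤n) step _ i refl
  where
  step : ∀ v → (∀ i → lookup π i ≡ inject₁ v → inject₁ v ≤ lookup σ i) →
         ∀ i → lookup π i ≡ suc v → suc v ≤ lookup σ i
  step v ih i πi≡1+v with injective⇒surjective (perm-injective π!) (inject₁ v)
  ... | j , πj≡v = ℕ.≤-<-trans
    (subst (λ x → x ℕ.≤ _) (toℕ-inject₁ v) (ih j πj≡v))
    (mono (subst₂ _<_ (sym πj≡v) (sym πi≡1+v) (inject₁<suc v)))

SameOrder : Word n → Word n → Set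
SameOrder π σ = ∀ {i j} → i < j → lookup π i < lookup π j ⇔ lookup σ i < lookup σ j

sameOrder⇒≤ : (π σ : Word n) → IsPermutation π → IsPermutation σ → SameOrder π σ →
              ∀ i → lookup π i ≤ lookup σ i
sameOrder⇒≤ π σ π! σ! same = order-preserving⇒≤ π σ π! mono
  where
  mono : ∀ {i j} → lookup π i < lookup π j → lookup σ i < lookup σ j
  mono {i} {j} πi<πj with <-cmp i j
  ... | tri< i<j _ _ = to (same i<j) πi<πj
  ... | tri≈ _ refl _ = contradiction πi<πj (<-irrefl refl)
  -- `SameOrder` only covers pairs in position order; a reversed pair is settled because distinct
  -- letters cannot tie.
  ... | tri> _ i≢j j<i =
    perm-≮⇒> σ! (i≢j ∘ sym) λ σj<σi → <-asym πi<πj (from (same j<i) σj<σi)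

-- Each word bounds the other letter by letter. Completeness of both codings rests on this.
sameOrder⇒≡ : {π σ : Word n} → IsPermutation π → IsPermutation σ → SameOrder π σ → π ≡ σ
sameOrder⇒≡ {π = π} {σ} π! σ! same = lookup-ext λ i →
  ≤-antisym (sameOrder⇒≤ π σ π! σ! same i)
            (sameOrder⇒≤ σ π σ! π! (λ i<j → mk⇔ (from (same i<j)) (to (same i<j))) i)

-- Building a permutation from a prescribed order of its positions.

-- U i j is only consulted for i < j, where it decides whether i is ranked
-- below j; the two hypotheses say exactly that the resulting order is transitive.
module Ranking
  (U : Rel (Fin n) 0ℓ) (U? : Decidable₂ U)
  (U-trans : ∀ {a b c} → a < b → b < c → U a b → U b c → U a c)
  (U-cotrans : ∀ {a b c} → a < b → b < c → U a c → U a b ⊎ U b c)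
  where

  _≺_ : Rel (Fin n) 0ℓ
  i ≺ j = (i < j × U i j) ⊎ (j < i × ¬ U j i)

  _≺?_ : Decidable₂ _≺_
  i ≺? j = (i <? j ×-dec U? i j) ⊎-dec (j <? i ×-dec ¬? (U? j i))

  ≺-irrefl : ∀ {i} → ¬ i ≺ i
  ≺-irrefl (inj₁ (i<i , _)) = <-irrefl refl i<i
  ≺-irrefl (inj₂ (i<i , _)) = <-irrefl refl i<i

  -- When both steps go the same way along the positions, one hypothesis on `U` suffices. When they
  -- turn back at `b`, the relative position of `a` and `c` decides which hypothesis applies to the
  -- sorted triple, and `a = c` is contradictory.
  ≺-trans : ∀ {a b c} → a ≺ b → b ≺ c → a ≺ c
  ≺-trans (inj₁ (a<b , Uab)) (inj₁ (b<c , Ubc)) = inj₁ (<-trans a<b b<c , U-trans a<b b<c Uab Ubc)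
  ≺-trans (inj₂ (b<a , ¬Uba)) (inj₂ (c<b , ¬Ucb)) =
    inj₂ (<-trans c<b b<a , λ Uca → [ ¬Ucb , ¬Uba ]′ (U-cotrans c<b b<a Uca))
  ≺-trans {a} {b} {c} (inj₁ (a<b , Uab)) (inj₂ (c<b , ¬Ucb)) with <-cmp a c
  ... | tri≈ _ refl _ = contradiction Uab ¬Ucb
  ... | tri> _ _ c<a = inj₂ (c<a , λ Uca → ¬Ucb (U-trans c<a a<b Uca Uab))
  ... | tri< a<c _ _ with U-cotrans a<c c<b Uab
  ...   | inj₁ Uac = inj₁ (a<c , Uac)
  ...   | inj₂ Ucb = contradiction Ucb ¬Ucb
  ≺-trans {a} {b} {c} (inj₂ (b<a , ¬Uba)) (inj₁ (b<c , Ubc)) with <-cmp a c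
  ... | tri≈ _ refl _ = contradiction Ubc ¬Uba
  ... | tri> _ _ c<a = inj₂ (c<a , λ Uca → ¬Uba (U-trans b<c c<a Ubc Uca))
  ... | tri< a<c _ _ with U-cotrans b<a a<c Ubc
  ...   | inj₁ Uba = contradiction Uba ¬Uba
  ...   | inj₂ Uac = inj₁ (a<c , Uac)

  <⇒≺-total : ∀ {i j} → i < j → i ≺ j ⊎ j ≺ i
  <⇒≺-total {i} {j} i<j with U? i j
  ... | yes Uij = inj₁ (inj₁ (i<j , Uij))
  ... | no ¬Uij = inj₂ (inj₂ (i<j , ¬Uij))

  below : Fin n → Subset n
  below i = ⟦ _≺? i ⟧

  -- The position `i` is missing from its own `below i`, so this subset is proper and its size is a
  -- legal letter.
  ∣below∣<n : ∀ i → ∣ below i ∣ ℕ.< n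
  ∣below∣<n i = subst (∣ below i ∣ ℕ.<_) (∣⊤∣≡n n)
    (p⊂q⇒∣p∣<∣q∣ (⊆⊤ , i , ∈⊤ , ≺-irrefl ∘ ∈⟦⟧⁻ (_≺? i)))

  rank : Fin n → Fin n
  rank i = fromℕ< (∣below∣<n i)

  -- Transitivity gives the inclusion of `below i` in `below j`, and `i` itself makes it strict.
  rank-mono : ∀ {i j} → i ≺ j → rank i < rank j
  rank-mono {i} {j} i≺j =
    subst₂ ℕ._<_ (sym (toℕ-fromℕ< (∣below∣<n i))) (sym (toℕ-fromℕ< (∣below∣<n j)))
      (p⊂q⇒∣p∣<∣q∣
        ( (λ k∈ → ∈⟦⟧⁺ (_≺? j) (≺-trans (∈⟦⟧⁻ (_≺? i) k∈) i≺j))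
        , i , ∈⟦⟧⁺ (_≺? j) i≺j , ≺-irrefl ∘ ∈⟦⟧⁻ (_≺? i)))

  rank-≢ : ∀ {i j} → i < j → rank i ≢ rank j
  rank-≢ i<j eq with <⇒≺-total i<j
  ... | inj₁ i≺j = <-irrefl eq (rank-mono i≺j)
  ... | inj₂ j≺i = <-irrefl (sym eq) (rank-mono j≺i)

  rank-injective : Injective _≡_ _≡_ rank
  rank-injective {i} {j} eq with <-cmp i j
  ... | tri< i<j _ _ = contradiction eq (rank-≢ i<j)
  ... | tri≈ _ i≡j _ = i≡j
  ... | tri> _ _ j<i = contradiction (sym eq) (rank-≢ j<i)

  ranking : Word n
  ranking = tabulate rank

  ranking-isPermutation : IsPermutation ranking
  ranking-isPermutation = tabulate⁺ rank-injective

  ranking-< : ∀ {i j} → i < j → lookup ranking i < lookup ranking j ⇔ U i j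
  ranking-< {i} {j} i<j rewrite lookup∘tabulate rank i | lookup∘tabulate rank j = mk⇔ ⇒ ⇐
    where
    ⇒ : rank i < rank j → U i j
    ⇒ ri<rj with U? i j
    ... | yes Uij = Uij
    ... | no ¬Uij = contradiction (rank-mono (inj₂ (i<j , ¬Uij))) (<-asym ri<rj)
    ⇐ : U i j → rank i < rank j
    ⇐ Uij = rank-mono (inj₁ (i<j , Uij))

-- Occurrences of patterns of length three.

lookup₃-mono : {x y z : Fin n} → x < y → y < z → Increasing (x ∷ y ∷ z ∷ [])
lookup₃-mono x<y y<z zero             (suc zero)       _ = x<y
lookup₃-mono x<y y<z zero             (suc (suc zero)) _ = <-trans x<y y<z
lookup₃-mono x<y y<z (suc zero)       (suc (suc zero)) _ = y<z
lookup₃-mono x<y y<z zero             zero             ()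
lookup₃-mono x<y y<z (suc zero)       zero             ()
lookup₃-mono x<y y<z (suc zero)       (suc zero)       (s≤s ())
lookup₃-mono x<y y<z (suc (suc zero)) zero             ()
lookup₃-mono x<y y<z (suc (suc zero)) (suc zero)       (s≤s ())
lookup₃-mono x<y y<z (suc (suc zero)) (suc (suc zero)) (s≤s (s≤s ()))

increasing-reflects : {is : Vec (Fin n) k} → Increasing is →
                      ∀ {a b} → lookup is a < lookup is b → a < b
increasing-reflects {is = is} inc {a} {b} lt with <-cmp a b
... | tri< a<b _ _ = a<b
... | tri≈ _ refl _ = contradiction lt (<-irrefl refl)
... | tri> _ _ b<a = contradiction (inc b a b<a) (<-asym lt)

-- x < y < z are the values of the occurrence, in increasing order.
contains₃ : (τ : Word 3) (π : Word n) {i j k x y z : Fin n} →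
  i < j → j < k → x < y → y < z →
  (∀ a → lookup π (lookup (i ∷ j ∷ k ∷ []) a) ≡ lookup (x ∷ y ∷ z ∷ []) (lookup τ a)) →
  Contains τ π
contains₃ τ π {i} {j} {k} {x} {y} {z} i<j j<k x<y y<z eq =
  i ∷ j ∷ k ∷ [] , lookup₃-mono i<j j<k , λ a b →
    subst₂ (λ u v → u < v ⇔ lookup τ a < lookup τ b) (sym (eq a)) (sym (eq b))
      (mk⇔ (increasing-reflects {is = x ∷ y ∷ z ∷ []} (lookup₃-mono x<y y<z))
           (lookup₃-mono x<y y<z _ _))

module _ (π : Word n) where

  contains-231 : ∀ {i j k} → i < j → j < k → lookup π k < lookup π i → lookup π i < lookup π j →
                 Contains 231ₚ π
  contains-231 i<j j<k πk<πi πi<πj = contains₃ 231ₚ π i<j j<k πk<πi πi<πj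
    λ { zero → refl ; (suc zero) → refl ; (suc (suc zero)) → refl }

  contains-312 : ∀ {i j k} → i < j → j < k → lookup π j < lookup π k → lookup π k < lookup π i →
                 Contains 312ₚ π
  contains-312 i<j j<k πj<πk πk<πi = contains₃ 312ₚ π i<j j<k πj<πk πk<πi
    λ { zero → refl ; (suc zero) → refl ; (suc (suc zero)) → refl }

  contains-213 : ∀ {i j k} → i < j → j < k → lookup π j < lookup π i → lookup π i < lookup π k →
                 Contains 213ₚ π
  contains-213 i<j j<k πj<πi πi<πk = contains₃ 213ₚ π i<j j<k πj<πi πi<πk
    λ { zero → refl ; (suc zero) → refl ; (suc (suc zero)) → refl }

  avoids-231 : (∀ {i j k} → i < j → j < k → lookup π k < lookup π i → ¬ lookup π i < lookup π j) →
               Avoids 231ₚ π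
  avoids-231 no-231 (i ∷ j ∷ k ∷ [] , inc , occ) =
    no-231 (inc zero (suc zero) (s≤s z≤n)) (inc (suc zero) (suc (suc zero)) (s≤s (s≤s z≤n)))
      -- The letters 0, 1, 2 of the pattern stand at places 2, 0, 1; comparing consecutive letters
      -- yields the two inequalities. The other two patterns are read in the same way.
      (from (occ (suc (suc zero)) zero) (s≤s z≤n)) (from (occ zero (suc zero)) (s≤s (s≤s z≤n)))

  avoids-312 : (∀ {i j k} → i < j → j < k → lookup π j < lookup π k → ¬ lookup π k < lookup π i) →
               Avoids 312ₚ π
  avoids-312 no-312 (i ∷ j ∷ k ∷ [] , inc , occ) =
    no-312 (inc zero (suc zero) (s≤s z≤n)) (inc (suc zero) (suc (suc zero)) (s≤s (s≤s z≤n)))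
      (from (occ (suc zero) (suc (suc zero))) (s≤s z≤n))
      (from (occ (suc (suc zero)) zero) (s≤s (s≤s z≤n)))

  avoids-213 : (∀ {i j k} → i < j → j < k → lookup π j < lookup π i → ¬ lookup π i < lookup π k) →
               Avoids 213ₚ π
  avoids-213 no-213 (i ∷ j ∷ k ∷ [] , inc , occ) =
    no-213 (inc zero (suc zero) (s≤s z≤n)) (inc (suc zero) (suc (suc zero)) (s≤s (s≤s z≤n)))
      (from (occ (suc zero) zero) (s≤s z≤n))
      (from (occ zero (suc (suc zero))) (s≤s (s≤s z≤n)))

-- Enumerating a class of permutations by codes.

Unique-vectors : {xs : List A} → Unique xs → ∀ k → Unique (vectors xs k)
Unique-vectors xs! zero    = [] ∷ []
Unique-vectors xs! (suc k) =
  cartesianProductWith⁺ _∷_ ∷-injective xs! (Unique-vectors xs! k)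

∈-subsets : (I : Subset m) → I Membership.∈ subsets m
∈-subsets = ∈-vectors λ { false → here refl ; true → there (here refl) }

Unique-subsets : ∀ m → Unique (subsets m)
Unique-subsets = Unique-vectors (((λ ()) ∷ []) ∷ [] ∷ [])

subset-≡ : {I J : Subset n} → (∀ i → i ∈ I ⇔ i ∈ J) → I ≡ J
subset-≡ I⇔J = ⊆-antisym (to (I⇔J _)) (from (I⇔J _))

AvoidingPermutation : Word k → Word m → Pred (Word n) 0ℓ
AvoidingPermutation τ ρ π = IsPermutation π × Avoids τ π × Avoids ρ π

-- Both lists are free of duplicates and have the same members, so they agree as bags and hence up
-- to reordering.
enumerates-S : (τ : Word k) (ρ : Word m) (f : A → Word n) {xs : List A} →
  Injective _≡_ _≡_ f → Unique xs → (∀ x → x Membership.∈ xs) →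
  (∀ x → AvoidingPermutation τ ρ (f x)) →
  (∀ {π} → AvoidingPermutation τ ρ π → ∃[ x ] π ≡ f x) →
  S n τ ρ ↭ map f xs
enumerates-S {n = n} τ ρ f {xs} f-inj xs! ∈-xs sound complete =
  ∼bag⇒↭ (unique∧set⇒bag
    (filter⁺ good? (Unique-vectors (allFin⁺ n) n))
    (Unique-map⁺ f-inj xs!)
    (mk⇔ S⊆map map⊆S))
  where
  good? : Decidable (AvoidingPermutation τ ρ)
  good? π = isPermutation? π ×-dec (avoids? τ π ×-dec avoids? ρ π)

  S⊆map : ∀ {π} → π Membership.∈ S n τ ρ → π Membership.∈ map f xs
  S⊆map π∈S with complete (proj₂ (∈-filter⁻ good? {xs = vectors (allFin n) n} π∈S))
  ... | x , refl = ∈-map⁺ f (∈-xs x)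

  map⊆S : ∀ {π} → π Membership.∈ map f xs → π Membership.∈ S n τ ρ
  map⊆S π∈map with ∈-map⁻ f π∈map
  ... | x , _ , refl = ∈-filter⁺ good? (∈-vectors ∈-allFin (f x)) (sound x)

¬ascent⇔descent : {π : Word (suc m)} → IsPermutation π → ∀ k → (¬ AscentAt π k) ⇔ DescentAt π k
¬ascent⇔descent {π = π} π! k =
  mk⇔ (perm-≮⇒> π! λ eq → <-irrefl eq (inject₁<suc k)) <-asym

-- The class avoiding 231 and 312.

-- Avoiding 231 and 312 means being layered: for i < j, π i < π j holds iff
-- some ascent separates the positions i and j.
module Layered {m : ℕ} where

  -- The index `k` stands for the adjacent positions `inject₁ k` and `suc k`; both must lie in the
  -- interval from `i` to `j`.
  Separates : Subset m → Rel (Fin (suc m)) 0ℓ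
  Separates I i j = ∃[ k ] k ∈ I × i ≤ inject₁ k × suc k ≤ j

  separates? : (I : Subset m) → Decidable₂ (Separates I)
  separates? I i j = any? λ k → k ∈? I ×-dec i ≤? inject₁ k ×-dec suc k ≤? j

  separates-widen : ∀ {I a b b′ c} → a ≤ b → b′ ≤ c → Separates I b b′ → Separates I a c
  separates-widen a≤b b′≤c (k , k∈I , b≤k , k<b′) =
    k , k∈I , ℕ.≤-trans a≤b b≤k , ℕ.≤-trans k<b′ b′≤c

  -- No position lies strictly between the two of an adjacent pair, so the pair lies entirely on one
  -- side of `b`, with `b` allowed as an endpoint.
  separates-split : ∀ {I a c} b → Separates I a c → Separates I a b ⊎ Separates I b c
  separates-split b (k , k∈I , a≤k , k<c) with inject₁ k <? b
  ... | yes k<b = inj₁ (k , k∈I , a≤k , inject₁<⇒suc≤ {j = b} k<b)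
  ... | no k≮b = inj₂ (k , k∈I , ℕ.≮⇒≥ k≮b , k<c)

  separates-step : ∀ {I} k → Separates I (inject₁ k) (suc k) ⇔ k ∈ I
  separates-step {I} k = mk⇔ ⇒ λ k∈I → k , k∈I , ℕ.≤-refl , ℕ.≤-refl
    where
    ⇒ : Separates I (inject₁ k) (suc k) → k ∈ I
    ⇒ (k′ , k′∈I , k≤k′ , s≤s k′≤k) = subst (_∈ I) (toℕ-injective (ℕ.≤-antisym k′≤k
      (subst₂ ℕ._≤_ (toℕ-inject₁ k) (toℕ-inject₁ k′) k≤k′))) k′∈I

  module Rank (I : Subset m) = Ranking (Separates I) (separates? I)
    -- Transitivity widens the first separation to the right; cotransitivity splits the interval at
    -- `b`.
    (λ _ b<c → λ Uab _ → separates-widen ℕ.≤-refl (ℕ.<⇒≤ b<c) Uab)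
    (λ {_} {b} _ _ → separates-split b)
  open Rank public using ()
    renaming (ranking to layered; ranking-isPermutation to layered-isPermutation;
              ranking-< to layered-<)

  ascentAt-layered : ∀ I k → AscentAt (layered I) k ⇔ k ∈ I
  ascentAt-layered I k = separates-step k ⇔-∘ layered-< I (inject₁<suc k)

  descentAt-layered : ∀ I k → DescentAt (layered I) k ⇔ k ∉ I
  descentAt-layered I k = mk⇔
    (λ d k∈I → from ¬asc⇔desc d (from (ascentAt-layered I k) k∈I))
    (λ k∉I → to ¬asc⇔desc (k∉I ∘ to (ascentAt-layered I k)))
    where ¬asc⇔desc = ¬ascent⇔descent (layered-isPermutation I) k

  -- A separator survives widening of the interval. The rise between the first two letters of a 231,
  -- or the last two of a 312, would therefore put the third letter above the first.
  layered-avoids : ∀ I → AvoidingPermutation 231ₚ 312ₚ (layered I)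
  layered-avoids I = layered-isPermutation I
    , avoids-231 (layered I) (λ i<j j<k k<i i<j′ → <-asym k<i (from (layered-< I (<-trans i<j j<k))
        (separates-widen ℕ.≤-refl (ℕ.<⇒≤ j<k) (to (layered-< I i<j) i<j′))))
    , avoids-312 (layered I) (λ i<j j<k j<k′ k<i → <-asym k<i (from (layered-< I (<-trans i<j j<k))
        (separates-widen (ℕ.<⇒≤ i<j) ℕ.≤-refl (to (layered-< I j<k) j<k′))))

  layered-injective : Injective _≡_ _≡_ layered
  layered-injective {I} {J} eq = subset-≡ λ k →
    subst (λ π → AscentAt π k ⇔ k ∈ J) (sym eq) (ascentAt-layered J k)
      ⇔-∘ ⇔-sym (ascentAt-layered I k)

  module _ {π : Word (suc m)} (π-avoids : AvoidingPermutation 231ₚ 312ₚ π) where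
    private
      π! = proj₁ π-avoids
      asc-π = ⟦ ascentAt? π ⟧

    -- Induction on `j`: if the last step is an ascent, it separates. If it is a descent, the letter
    -- before `j` is larger still, and the induction hypothesis provides a separator further left.
    <⇒separates : ∀ i j → i < j → lookup π i < lookup π j → Separates asc-π i j
    <⇒separates i = <-weakInduction _ (λ ()) step
      where
      step : ∀ j →
        (i < inject₁ j → lookup π i < lookup π (inject₁ j) → Separates asc-π i (inject₁ j)) →
        i < suc j → lookup π i < lookup π (suc j) → Separates asc-π i (suc j)
      step j ih i<1+j πi<π1+j with lookup π (inject₁ j) <? lookup π (suc j)
      ... | yes asc = j , ∈⟦⟧⁺ (ascentAt? π) asc , i≤j , ℕ.≤-refl
        where i≤j = subst (toℕ i ℕ.≤_) (sym (toℕ-inject₁ j)) (ℕ.≤-pred i<1+j)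
      ... | no ¬asc = separates-widen ℕ.≤-refl (ℕ.<⇒≤ (inject₁<suc j)) (ih i<j πi<πj)
        where
        πi<πj = <-trans πi<π1+j (to (¬ascent⇔descent π! j) ¬asc)
        -- The induction hypothesis needs a strict inequality of positions; equality would compare a
        -- letter with itself.
        i<j = ≤∧≢⇒< (subst (toℕ i ℕ.≤_) (sym (toℕ-inject₁ j)) (ℕ.≤-pred i<1+j))
          λ { refl → <-irrefl refl πi<πj }

    -- Otherwise `i`, `inject₁ k`, `suc k` would carry a 312.
    ascent⇒< : ∀ {i k} → i ≤ inject₁ k → AscentAt π k → lookup π i < lookup π (suc k)
    ascent⇒< {i} {k} i≤k asc with i ≟ inject₁ k
    ... | yes refl = asc
    ... | no i≢k = decidable-stable (_ <? _) λ ≮ → proj₂ (proj₂ π-avoids)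
      (contains-312 π i<k (inject₁<suc k) asc
        (perm-≮⇒> π! (λ { refl → <-asym i<k (inject₁<suc k) }) ≮))
      where i<k = ≤∧≢⇒< i≤k i≢k

    -- The letter at `suc k` exceeds the one at `i`; were the letter at `j` smaller than the one at
    -- `i`, then `i`, `suc k`, `j` would carry a 231.
    separates⇒< : ∀ {i j} → Separates asc-π i j → lookup π i < lookup π j
    separates⇒< {i} {j} (k , k∈ , i≤k , k<j) with suc k ≟ j
    ... | yes refl = ascent⇒< i≤k (∈⟦⟧⁻ (ascentAt? π) k∈)
    ... | no 1+k≢j = decidable-stable (_ <? _) λ ≮ → proj₁ (proj₂ π-avoids)
      (contains-231 π i<1+k 1+k<j
        (perm-≮⇒> π! (λ { refl → <-asym i<1+k 1+k<j }) ≮)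
        (ascent⇒< i≤k (∈⟦⟧⁻ (ascentAt? π) k∈)))
      where
      i<1+k = ℕ.≤-<-trans i≤k (inject₁<suc k)
      1+k<j = ≤∧≢⇒< k<j 1+k≢j

    layered-complete : π ≡ layered asc-π
    layered-complete = sameOrder⇒≡ π! (layered-isPermutation asc-π) λ {i} {j} i<j →
      ⇔-sym (layered-< asc-π i<j) ⇔-∘ mk⇔ (<⇒separates i j i<j) separates⇒<

  S↭layered : S (suc m) 231ₚ 312ₚ ↭ map layered (subsets m)
  S↭layered = enumerates-S 231ₚ 312ₚ layered layered-injective (Unique-subsets m) ∈-subsets
    layered-avoids (λ π-avoids → _ , layered-complete π-avoids)

-- The class avoiding 213 and 231.

-- Avoiding 213 and 231 means that every letter is the minimum or the maximum of
-- the suffix it starts: for i < j, σ i < σ j holds iff σ has no descent at i.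
module Extremal {m : ℕ} where

  -- Codes live on the `m` adjacent pairs, while ranking compares `suc m` positions; the last
  -- position starts no pair.
  StartsAt : Subset m → Pred (Fin (suc m)) 0ℓ
  StartsAt I i = ∃[ k ] k ∈ I × inject₁ k ≡ i

  startsAt? : (I : Subset m) → Decidable (StartsAt I)
  startsAt? I i = any? λ k → k ∈? I ×-dec inject₁ k ≟ i

  startsAt-inject₁ : ∀ {I} k → StartsAt I (inject₁ k) ⇔ k ∈ I
  startsAt-inject₁ {I} k = mk⇔
    (λ (k′ , k′∈I , eq) → subst (_∈ I) (inject₁-injective eq) k′∈I) (λ k∈I → k , k∈I , refl)

  module Rank (I : Subset m) = Ranking (λ i _ → ¬ StartsAt I i) (λ i _ → ¬? (startsAt? I i))
    -- The relation ignores its right argument, so both conditions reduce to the same statement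
    -- about `a`.
    (λ _ _ Ua _ → Ua) (λ _ _ → inj₁)
  open Rank public using ()
    renaming (ranking to extremal; ranking-isPermutation to extremal-isPermutation;
              ranking-< to extremal-<)

  ascentAt-extremal : ∀ I k → AscentAt (extremal I) k ⇔ k ∉ I
  ascentAt-extremal I k = mk⇔ (_∘ from (startsAt-inject₁ k)) (_∘ to (startsAt-inject₁ k))
    ⇔-∘ extremal-< I (inject₁<suc k)

  descentAt-extremal : ∀ I k → DescentAt (extremal I) k ⇔ k ∈ I
  descentAt-extremal I k = mk⇔
    (λ d → decidable-stable (k ∈? I) (from ¬asc⇔desc d ∘ from (ascentAt-extremal I k)))
    (λ k∈I → to ¬asc⇔desc λ asc → to (ascentAt-extremal I k) asc k∈I)
    where ¬asc⇔desc = ¬ascent⇔descent (extremal-isPermutation I) k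

  -- Both patterns begin with their middle letter, whereas here a position compares in the same way
  -- with every later one.
  extremal-avoids : ∀ I → AvoidingPermutation 213ₚ 231ₚ (extremal I)
  extremal-avoids I = extremal-isPermutation I
    , avoids-213 (extremal I) (λ i<j j<k j<i i<k → <-asym j<i
        (from (extremal-< I i<j) (to (extremal-< I (<-trans i<j j<k)) i<k)))
    , avoids-231 (extremal I) (λ i<j j<k k<i i<j′ → <-asym k<i
        (from (extremal-< I (<-trans i<j j<k)) (to (extremal-< I i<j) i<j′)))

  extremal-injective : Injective _≡_ _≡_ extremal
  extremal-injective {I} {J} eq = subset-≡ λ k →
    subst (λ π → DescentAt π k ⇔ k ∈ J) (sym eq) (descentAt-extremal J k)
      ⇔-∘ ⇔-sym (descentAt-extremal I k)

  module _ {σ : Word (suc m)} (σ-avoids : AvoidingPermutation 213ₚ 231ₚ σ) where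
    private
      σ! = proj₁ σ-avoids
      des-σ = ⟦ descentAt? σ ⟧

    -- If the comparisons of `inject₁ k` with `suc k` and with `j` disagreed, these three positions
    -- would carry a 213 (descent first) or a 231 (ascent first).
    <⇔ascent : ∀ {k j} → inject₁ k < j → lookup σ (inject₁ k) < lookup σ j ⇔ AscentAt σ k
    <⇔ascent {k} {j} k<j with suc k ≟ j
    ... | yes refl = mk⇔ id id
    ... | no 1+k≢j = mk⇔
      (λ σk<σj → decidable-stable (_ <? _) λ ¬asc → proj₁ (proj₂ σ-avoids)
        (contains-213 σ (inject₁<suc k) 1+k<j (to (¬ascent⇔descent σ! k) ¬asc) σk<σj))
      (λ asc → decidable-stable (_ <? _) λ ≮ → proj₂ (proj₂ σ-avoids)
        (contains-231 σ (inject₁<suc k) 1+k<j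
          (perm-≮⇒> σ! (λ eq → <-irrefl eq k<j) ≮) asc))
      where 1+k<j = ≤∧≢⇒< (inject₁<⇒suc≤ {j = j} k<j) 1+k≢j

    <⇔¬startsAt : ∀ {i j} → i < j → lookup σ i < lookup σ j ⇔ (¬ StartsAt des-σ i)
    <⇔¬startsAt {i} {j} i<j = mk⇔ ⇒ ⇐
      where
      ⇒ : lookup σ i < lookup σ j → ¬ StartsAt des-σ i
      ⇒ σi<σj (k , k∈ , refl) = <-asym (to (<⇔ascent i<j) σi<σj) (∈⟦⟧⁻ (descentAt? σ) k∈)

      ⇐ : ¬ StartsAt des-σ i → lookup σ i < lookup σ j
      -- Since `j` comes later, `i` is not the last position and so has the form `inject₁ k`.
      ⇐ ¬starts with ℕ.<-≤-trans i<j (ℕ.≤-pred (toℕ<n j))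
      ... | i<m with lower₁ i (ℕ.<⇒≢ i<m ∘ sym) | inject₁-lower₁ i (ℕ.<⇒≢ i<m ∘ sym)
      ...   | k | refl = from (<⇔ascent i<j) (decidable-stable (_ <? _) λ ¬asc →
                ¬starts (k , ∈⟦⟧⁺ (descentAt? σ) (to (¬ascent⇔descent σ! k) ¬asc) , refl))

    extremal-complete : σ ≡ extremal des-σ
    extremal-complete = sameOrder⇒≡ σ! (extremal-isPermutation des-σ) λ i<j →
      ⇔-sym (extremal-< des-σ i<j) ⇔-∘ <⇔¬startsAt i<j

  S↭extremal : S (suc m) 213ₚ 231ₚ ↭ map extremal (subsets m)
  S↭extremal = enumerates-S 213ₚ 231ₚ extremal extremal-injective (Unique-subsets m) ∈-subsets
    extremal-avoids (λ σ-avoids → _ , extremal-complete σ-avoids)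

-- Transfer of the four statistics.

module _ {P Q : Pred (Fin n) 0ℓ} (P? : Decidable P) (Q? : Decidable Q) (P⇔Q : ∀ i → P i ⇔ Q i) where

  count-cong : count P? ≡ count Q?
  count-cong = cong length (filter-≐ P? Q? ((λ {i} → to (P⇔Q i)) , λ {i} → from (P⇔Q i)) (allFin _))

  maxNonAdjacent-cong : maxNonAdjacent P? ≡ maxNonAdjacent Q?
  maxNonAdjacent-cong = cong (λ Is → max 0 (map ∣_∣ Is)) (filter-≐ (nonAdjacent? P?) (nonAdjacent? Q?)
    ( (λ (I⊆P , far) → (λ i i∈I → to (P⇔Q i) (I⊆P i i∈I)) , far)
    , (λ (I⊆Q , far) → (λ i i∈I → from (P⇔Q i) (I⊆Q i i∈I)) , far)) (subsets n))

ascDes desAsc : Word n → Quadruple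
ascDes π = asc π , des π , MNA π , MND π
desAsc σ = des σ , asc σ , MND σ , MNA σ

ascDes≡desAsc : (π σ : Word (suc m)) →
  (∀ k → AscentAt π k ⇔ DescentAt σ k) → (∀ k → DescentAt π k ⇔ AscentAt σ k) →
  ascDes π ≡ desAsc σ
ascDes≡desAsc π σ a⇔d d⇔a = cong₂ _,_ (count-cong (ascentAt? π) (descentAt? σ) a⇔d)
  (cong₂ _,_ (count-cong (descentAt? π) (ascentAt? σ) d⇔a)
  (cong₂ _,_ (maxNonAdjacent-cong (ascentAt? π) (descentAt? σ) a⇔d)
             (maxNonAdjacent-cong (descentAt? π) (ascentAt? σ) d⇔a)))

stats-↭ : ∀ n → map ascDes (S n 231ₚ 312ₚ) ↭ map desAsc (S n 213ₚ 231ₚ)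
-- Codes require length `suc m`. For length 0 both classes consist of the empty word, whose
-- statistics all vanish.
stats-↭ zero = ↭-refl
stats-↭ (suc m) = begin
  map ascDes (S (suc m) 231ₚ 312ₚ)       ↭⟨ ↭-map⁺ ascDes S↭layered ⟩
  map ascDes (map layered (subsets m))   ≡⟨ map-∘ (subsets m) ⟨
  map (ascDes ∘ layered) (subsets m)     ≡⟨ map-cong same-stats (subsets m) ⟩
  map (desAsc ∘ extremal) (subsets m)    ≡⟨ map-∘ (subsets m) ⟩
  map desAsc (map extremal (subsets m))  ↭⟨ ↭-map⁺ desAsc S↭extremal ⟨
  map desAsc (S (suc m) 213ₚ 231ₚ)       ∎
  where
  open PermutationReasoning
  open Layered
  open Extremal

  same-stats : ∀ I → ascDes (layered I) ≡ desAsc (extremal I)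
  same-stats I = ascDes≡desAsc (layered I) (extremal I)
    (λ k → ⇔-sym (descentAt-extremal I k) ⇔-∘ ascentAt-layered I k)
    (λ k → ⇔-sym (ascentAt-extremal I k) ⇔-∘ descentAt-layered I k)

-- From reordered quadruples to distributions and generating functions.

-- Forgetting the words leaves a count on the list of quadruples, where reordering can be applied.
distribution-map : (stat : A → Quadruple) (xs : List A) (q : Quadruple) →
                   distribution stat xs q ≡ distribution id (map stat xs) q
distribution-map stat []       q = refl
distribution-map stat (x ∷ xs) q with does (stat x ≟⁴ q)
... | true  = cong suc (distribution-map stat xs q)
... | false = distribution-map stat xs q

distribution-↭ : {f : A → Quadruple} {g : B → Quadruple} {xs : List A} {ys : List B} →
  map f xs ↭ map g ys → ∀ q → distribution f xs q ≡ distribution g ys q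
distribution-↭ {f = f} {g} {xs} {ys} fxs↭gys q = trans (distribution-map f xs q)
  (trans (↭-length (filter-↭ (_≟⁴ q) fxs↭gys)) (sym (distribution-map g ys q)))

module _ (R : CommutativeSemiring c ℓ) where
  open CommutativeSemiring R using (Carrier; _≈_; +-isCommutativeMonoid; reflexive)
    renaming (setoid to R-setoid)

  generatingFunction-↭ : {f : A → Quadruple} {g : B → Quadruple} {xs : List A} {ys : List B} →
    map f xs ↭ map g ys → (t₁ t₂ t₃ t₄ : Carrier) →
    generatingFunction R f xs t₁ t₂ t₃ t₄ ≈ generatingFunction R g ys t₁ t₂ t₃ t₄
  generatingFunction-↭ {f = f} {g} {xs} {ys} fxs↭gys t₁ t₂ t₃ t₄
    -- Factoring both sums through the quadruples lets the reordering pass through `monomial`; a sum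
    -- in a commutative monoid does not depend on the order of its terms.
    rewrite map-∘ {g = monomial R t₁ t₂ t₃ t₄} {f} xs
          | map-∘ {g = monomial R t₁ t₂ t₃ t₄} {g} ys =
    Permutationₛ.foldr-commMonoid R-setoid +-isCommutativeMonoid
      (Permutationₛ.map⁺ (setoid Quadruple) R-setoid
        (reflexive ∘ cong (monomial R t₁ t₂ t₃ t₄)) (↭⇒↭ₛ fxs↭gys))

theorem15 : ∀ {c ℓ} (n : ℕ) →
    (∀ q → distribution (λ π → asc π , des π , MNA π , MND π) (S n 231ₚ 312ₚ) q
    ≡ distribution (λ σ → des σ , asc σ , MND σ , MNA σ) (S n 213ₚ 231ₚ) q)
    ×
    (∀ (R : CommutativeSemiring c ℓ) → let open CommutativeSemiring R in
    ∀ (t₁ t₂ t₃ t₄ : Carrier) →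
    generatingFunction R (λ π → asc π , des π , MNA π , MND π) (S n 231ₚ 312ₚ) t₁ t₂ t₃ t₄
    ≈ generatingFunction R (λ σ → des σ , asc σ , MND σ , MNA σ) (S n 213ₚ 231ₚ) t₁ t₂ t₃ t₄)
theorem15 n = distribution-↭ (stats-↭ n) , λ R → generatingFunction-↭ R (stats-↭ n)
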